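{- Let $q=2^r$. For a finite group $G$ of matrices over $\mathbb{F}_q$ with elements listed as $g_1,\ldots,g_N$, and $a\in\mathbb{F}_q$, put $c(a)=(tr(a\,\mathrm{Tr}\,g_1),\ldots,tr(a\,\mathrm{Tr}\,g_N))\in\mathbb{F}_2^N$; these vectors lie in the dual code $C(G)^\perp\subseteq\mathbb{F}_2^N$. Then: (a) if $r\ge3$, the map $\mathbb{F}_q\to C(G)^\perp$, $a\mapsto c(a)$, is an $\mathbb{F}_2$-linear isomorphism for $G=SO^+(2,q)$ and for $G=O^+(2,q)$; (b) for every $r\ge1$, the map $\mathbb{F}_q\to C(SO^+(4,q))^\perp$, $a\mapsto c(a)$, is an $\mathbb{F}_2$-linear isomorphism.
   Context: $tr(x)=x+x^2+\cdots+x^{2^{r-1}}$ is the absolute trace $\mathbb{F}_q\to\mathbb{F}_2$; $\mathrm{Tr}$ is the matrix trace. The binary code $C(G)=\{u\in\mathbb{F}_2^N:\ \sum_{j=1}^N u_j\,\mathrm{Tr}(g_j)=0\text{ in }\mathbb{F}_q\}$ and $C(G)^\perp$ is its dual with respect to the standard inner product on $\mathbb{F}_2^N$. On column vectors $x\in\mathbb{F}_q^{2n}$ let $\theta^+(x)=\sum_{i=1}^n x_ix_{n+i}$; $O^+(2n,q)$ is the group of $g\in GL(2n,q)$ preserving $\theta^+$; equivalently, writing $g=\begin{bmatrix}A&B\\C&D\end{bmatrix}$ with $n\times n$ blocks, ${}^tAC,{}^tBD$ are alternating (symmetric with zero diagonal) and ${}^tAD+{}^tCB=1_n$. The map $\delta^+(g)=\mathrm{Tr}(B\,{}^tC)$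 is a surjective homomorphism $O^+(2n,q)\to\mathbb{F}_2$ and $SO^+(2n,q)=\ker\delta^+$. -}

module Defs where

open import Level using (0ℓ)
open import Data.Nat as ℕ using (ℕ; zero; suc)
import Data.Fin
open import Data.Fin using (Fin; _↑ˡ_; _↑ʳ_)
open import Data.Bool using (Bool; true; false; _xor_; _∧_; if_then_else_; not)
open import Data.List using (List; length; lookup)
open import Data.List.Membership.Propositional using (_∈_)
open import Data.List.Relation.Unary.Unique.Propositional using (Unique)
open import Data.Product using (Σ; ∃; _×_; _,_)
open import Relation.Nullary using (¬_; Dec; does)
open import Relation.Binary.PropositionalEquality using (_≡_; _≢_)
open import Relation.Binary using (Decidable)
open import Algebra.Structures using (IsCommutativeRing)
open import Function using (_⇔_)

-- A finite field with q = 2^r elements (F_q is unique up to isomorphism,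
-- so we quantify over an arbitrary such field).

record FiniteField2 (r : ℕ) : Set₁ where
  infixl 6 _+_
  infixl 7 _*_
  field
    F      : Set
    _+_    : F → F → F
    _*_    : F → F → F
    -_     : F → F
    0# 1#  : F
    isCommutativeRing : IsCommutativeRing _≡_ _+_ _*_ -_ 0# 1#
    0≢1    : 0# ≢ 1#
    inverse : ∀ x → x ≢ 0# → ∃ λ y → x * y ≡ 1#
    char2  : 1# + 1# ≡ 0#
    _≟_    : Decidable {A = F} _≡_
    elements : List F
    elements-complete : ∀ x → x ∈ elements
    elements-unique   : Unique elements
    elements-size     : length elements ≡ 2 ℕ.^ r

module Over {r : ℕ} (K : FiniteField2 r) where
  open FiniteField2 K public

  Σ[_]_ : (n : ℕ) → (Fin n → F) → F
  Σ[ zero ] f = 0#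
  Σ[ suc n ] f = f Data.Fin.zero + Σ[ n ] (λ i → f (Data.Fin.suc i))

  -- absolute trace tr : F_q → F_2 (valued in the prime field {0,1} ⊆ F_q)
  -- tr x = x + x^2 + ... + x^(2^(r-1)) = Σ_{i<r} x^(2^i)
  _^_ : F → ℕ → F
  x ^ zero = 1#
  x ^ suc n = x * (x ^ n)

  tr : F → F
  tr x = Σ[ r ] (λ i → x ^ (2 ℕ.^ Data.Fin.toℕ i))

  Mat : ℕ → Set
  Mat m = Fin m → Fin m → F

  _≐_ : ∀ {m} → Mat m → Mat m → Set
  g ≐ h = ∀ i j → g i j ≡ h i j

  _⊗_ : ∀ {m} → Mat m → Mat m → Mat m
  (g ⊗ h) i j = Σ[ _ ] (λ k → g i k * h k j)

  idM : ∀ {m} → Mat m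
  idM {m} i j with does (Data.Fin._≟_ i j)
  ... | true  = 1#
  ... | false = 0#

  Tr : ∀ {m} → Mat m → F
  Tr {m} g = Σ[ m ] (λ i → g i i)

  act : ∀ {m} → Mat m → (Fin m → F) → (Fin m → F)
  act {m} g x i = Σ[ m ] (λ k → g i k * x k)

  GL : ∀ m → Mat m → Set
  GL m g = Σ (Mat m) λ h → (g ⊗ h) ≐ idM × (h ⊗ g) ≐ idM

  θ⁺ : ∀ n → (Fin (n ℕ.+ n) → F) → F
  θ⁺ n x = Σ[ n ] (λ i → x (i ↑ˡ n) * x (n ↑ʳ i))

  O⁺ : ∀ n → Mat (n ℕ.+ n) → Set
  O⁺ n g = GL (n ℕ.+ n) g × (∀ x → θ⁺ n (act g x) ≡ θ⁺ n x)

  blockB blockC : ∀ n → Mat (n ℕ.+ n) → Fin n → Fin n → F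
  blockB n g i j = g (i ↑ˡ n) (n ↑ʳ j)
  blockC n g i j = g (n ↑ʳ i) (j ↑ˡ n)

  -- δ⁺(g) = Tr(B ᵗC) = Σ_{i,j} B_ij C_ij
  δ⁺ : ∀ n → Mat (n ℕ.+ n) → F
  δ⁺ n g = Σ[ n ] (λ i → Σ[ n ] (λ j → blockB n g i j * blockC n g i j))

  SO⁺ : ∀ n → Mat (n ℕ.+ n) → Set
  SO⁺ n g = O⁺ n g × δ⁺ n g ≡ 0#

  record Listing (m : ℕ) (G : Mat m → Set) : Set₁ where
    field
      N     : ℕ
      g     : Fin N → Mat m
      sound : ∀ j → G (g j)
      complete : ∀ h → G h → ∃ λ j → g j ≐ h
      distinct : ∀ i j → g i ≐ g j → i ≡ j

  -- binary words of length N, with F_2 = Bool (xor = +, ∧ = ·)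
  Word : ℕ → Set
  Word N = Fin N → Bool

  _≗w_ : ∀ {N} → Word N → Word N → Set
  u ≗w v = ∀ j → u j ≡ v j

  ⊕[_]_ : (N : ℕ) → (Fin N → Bool) → Bool
  ⊕[ zero ] f = false
  ⊕[ suc n ] f = f Data.Fin.zero xor ⊕[ n ] (λ i → f (Data.Fin.suc i))

  ⟨_,_⟩ : ∀ {N} → Word N → Word N → Bool
  ⟨_,_⟩ {N} u v = ⊕[ N ] (λ j → u j ∧ v j)

  ι : Bool → F
  ι true  = 1#
  ι false = 0#

  -- identify an element of the prime field {0,1} ⊆ F_q with F_2
  toF2 : F → Bool
  toF2 x = not (does (x ≟ 0#))

  module _ {m : ℕ} {G : Mat m → Set} (L : Listing m G) where
    open Listing L

    C : Word N → Set
    C u = Σ[ N ] (λ j → ι (u j) * Tr (g j)) ≡ 0#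

    C⊥ : Word N → Set
    C⊥ v = ∀ u → C u → ⟨ u , v ⟩ ≡ false

    c : F → Word N
    c a j = toF2 (tr (a * Tr (g j)))

    IsIsoOntoDual : Set
    IsIsoOntoDual =
        (∀ a → C⊥ (c a))
      × (∀ a b → c (a + b) ≗w (λ j → c a j xor c b j))
      × (∀ a b → c a ≗w c b → a ≡ b)
      × (∀ v → C⊥ v → ∃ λ a → c a ≗w v)

{-# OPTIONS --safe #-}
module Submission where

-- The relation ⟨u , c(a)⟩ = tr(a · Σ uⱼ Tr gⱼ) gives c(a) ∈ C(G)^⊥.  Surjectivity holds for every G:
-- by the Fredholm alternative over 𝔽₂, a word v not of the form c(a) is detected by some u with
-- ⟨u , c(a)⟩ = 0 for all a and ⟨u , v⟩ = 1; nondegeneracy of the trace form puts u in C(G), so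
-- v ∉ C(G)^⊥.  Injectivity says that tr(d · Tr g) = 0 for all g ∈ G forces d = 0.  For SO⁺(4,q)
-- every t ∈ 𝔽_q is the trace of some g, and nondegeneracy applies again.  For SO⁺(2,q) ⊆ O⁺(2,q)
-- the traces include x + 1/x, and tr(d(x + 1/x)) = 0 for all x ≠ 0 gives, after clearing
-- denominators, a polynomial with more roots than its degree.

open import Defs
open import Algebra.Bundles using (CommutativeRing; RawRing)
import Algebra.Properties.Ring
import Algebra.Solver.Ring
open import Algebra.Solver.Ring.AlmostCommutativeRing using (fromCommutativeRing; _-Raw-AlmostCommutative⟶_)
open import Data.Bool using (Bool; true; false; _xor_; _∧_)
import Data.Bool.Properties as Bool
open import Data.Bool.Solver using (module xor-∧-Solver)
open import Data.Empty using (⊥-elim)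
open import Data.Fin as Fin using (Fin; toℕ)
open import Data.Fin.Properties using (toℕ<n)
open import Data.Fin.Patterns using (0F; 1F; 2F; 3F)
open import Data.List as List using (List; []; _∷_; length; filter; foldr)
open import Data.List.Membership.Propositional using (_∈_; find; lose)
open import Data.List.Membership.Propositional.Properties using (∈-filter⁺; ∈-filter⁻; ∈-map⁺; ∈-map⁻)
open import Data.List.Membership.Propositional.Properties.WithK using (unique∧set⇒bag)
open import Data.List.Relation.Binary.BagAndSetEquality using (∼bag⇒↭)
open import Data.List.Relation.Binary.Permutation.Propositional using (_↭_; ↭⇒↭ₛ)
open import Data.List.Relation.Binary.Permutation.Propositional.Properties using (↭-length)
import Data.List.Relation.Binary.Permutation.Setoid.Properties as PermutationSetoid
open import Data.List.Relation.Unary.All as All using (All; []; _∷_)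
open import Data.List.Relation.Unary.Any using (any?; here; there)
open import Data.List.Relation.Unary.AllPairs using ([]; _∷_)
open import Data.List.Relation.Unary.Unique.Propositional using (Unique)
import Data.List.Relation.Unary.Unique.Propositional.Properties as Unique
open import Data.Maybe using (just; nothing)
open import Data.Nat as ℕ using (ℕ; zero; suc; _≤_; _<_; z≤n; s≤s)
import Data.Nat.Properties as ℕ
open import Data.Product using (Σ; ∃; _×_; _,_; proj₁; proj₂)
open import Data.Sum using (_⊎_; inj₁; inj₂)
open import Data.Vec as Vec using (Vec; []; _∷_)
open import Function using (_∘_; mk⇔)
open import Level using (0ℓ)
open import Relation.Binary.Definitions using (WeaklyDecidable)
open import Relation.Binary.PropositionalEquality using (_≡_; _≢_; refl; sym; trans; cong; cong₂; subst; subst₂; setoid; module ≡-Reasoning)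
open import Relation.Nullary using (¬_; does; yes; no; ¬?)

-- Powers of two and duplicate-free lists.

2^suc : ∀ n → 2 ℕ.^ suc n ≡ 2 ℕ.^ n ℕ.+ 2 ℕ.^ n
2^suc n = cong (2 ℕ.^ n ℕ.+_) (ℕ.+-identityʳ (2 ℕ.^ n))

2^-mono-≤ : ∀ {m n} → m ≤ n → 2 ℕ.^ m ≤ 2 ℕ.^ n
2^-mono-≤ = ℕ.^-monoʳ-≤ 2

2^-mono-< : ∀ {m n} → m < n → 2 ℕ.^ m < 2 ℕ.^ n
2^-mono-< = ℕ.^-monoʳ-< 2 (s≤s (s≤s z≤n))

-- Without duplicates every membership has multiplicity one, so equality as sets is already equality
-- as bags.
unique-↭ : ∀ {A : Set} {xs ys : List A} → Unique xs → Unique ys →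
           (∀ {z} → z ∈ xs → z ∈ ys) → (∀ {z} → z ∈ ys → z ∈ xs) → xs ↭ ys
unique-↭ u v f g = ∼bag⇒↭ (unique∧set⇒bag u v (mk⇔ f g))

-- Field arithmetic in characteristic 2.

module FieldProperties {r : ℕ} (K : FiniteField2 r) where
  open Over K
  open ≡-Reasoning

  commutativeRing : CommutativeRing 0ℓ 0ℓ
  commutativeRing = record { isCommutativeRing = isCommutativeRing }

  open CommutativeRing commutativeRing public using
    ( +-identityˡ; +-identityʳ; +-assoc; +-comm; *-identityˡ; *-identityʳ; *-assoc; *-comm
    ; distribˡ; distribʳ; zeroˡ; zeroʳ; *-isCommutativeMonoid; ring)

  -1≡1 : (- 1#) ≡ 1#
  -1≡1 = sym (Algebra.Properties.Ring.+-inverseʳ-unique ring 1# 1# char2)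

  ι-xor : ∀ a b → ι (a xor b) ≡ ι a + ι b
  ι-xor true  true  = sym char2
  ι-xor true  false = sym (+-identityʳ 1#)
  ι-xor false b     = sym (+-identityˡ (ι b))

  ι-∧ : ∀ a b → ι (a ∧ b) ≡ ι a * ι b
  ι-∧ true  b = sym (*-identityˡ (ι b))
  ι-∧ false b = sym (zeroˡ (ι b))

  ι-injective : ∀ a b → ι a ≡ ι b → a ≡ b
  ι-injective true  true  _ = refl
  ι-injective false false _ = refl
  ι-injective true  false e = ⊥-elim (0≢1 (sym e))
  ι-injective false true  e = ⊥-elim (0≢1 e)

  𝔽₂ : RawRing 0ℓ 0ℓ
  𝔽₂ = record { Carrier = Bool ; _≈_ = _≡_ ; _+_ = _xor_ ; _*_ = _∧_ ; -_ = λ x → x ; 0# = false ; 1# = true }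

  𝔽₂⟶F : 𝔽₂ -Raw-AlmostCommutative⟶ fromCommutativeRing commutativeRing
  𝔽₂⟶F = record
    { ⟦_⟧ = ι ; +-homo = ι-xor ; *-homo = ι-∧
    ; -‿homo = λ { true → sym -1≡1 ; false → sym (Algebra.Properties.Ring.-0#≈0# ring) }
    ; 0-homo = refl ; 1-homo = refl }

  ι-≟ : WeaklyDecidable (λ a b → ι a ≡ ι b)
  ι-≟ a b with a Bool.≟ b
  ... | yes e = just (cong ι e)
  ... | no _  = nothing

  -- Taking coefficients in 𝔽₂ lets the solver use characteristic 2.
  module Solver = Algebra.Solver.Ring 𝔽₂ (fromCommutativeRing commutativeRing) 𝔽₂⟶F ι-≟
  open Solver using (solve; prove; Polynomial; var; con; _:=_; _:+_; _:*_)

  x+x≡0 : ∀ x → x + x ≡ 0#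
  x+x≡0 = solve 1 (λ x → x :+ x := con false) refl

  x+y≡0⇒x≡y : ∀ {x y} → x + y ≡ 0# → x ≡ y
  x+y≡0⇒x≡y {x} {y} e = begin
    x           ≡⟨ solve 2 (λ x y → x := (x :+ y) :+ y) refl x y ⟩
    (x + y) + y ≡⟨ cong (_+ y) e ⟩
    0# + y      ≡⟨ +-identityˡ y ⟩
    y           ∎

  *-cancelˡ : ∀ {x} y z → x ≢ 0# → x * y ≡ x * z → y ≡ z
  *-cancelˡ {x} y z x≢0 e with inverse x x≢0
  ... | w , xw≡1 = begin
    y           ≡⟨ unit y ⟩
    w * (x * y) ≡⟨ cong (w *_) e ⟩
    w * (x * z) ≡⟨ unit z ⟨
    z           ∎
    where
    unit : ∀ y → y ≡ w * (x * y)
    unit y = begin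
      y            ≡⟨ *-identityˡ y ⟨
      1# * y       ≡⟨ cong (_* y) xw≡1 ⟨
      (x * w) * y  ≡⟨ solve 3 (λ x w y → (x :* w) :* y := w :* (x :* y)) refl x w y ⟩
      w * (x * y)  ∎

  xy≡0⇒y≡0 : ∀ {x y} → x ≢ 0# → x * y ≡ 0# → y ≡ 0#
  xy≡0⇒y≡0 {x} {y} x≢0 e = *-cancelˡ y 0# x≢0 (trans e (sym (zeroʳ x)))

  xy≢0 : ∀ {x y} → x ≢ 0# → y ≢ 0# → x * y ≢ 0#
  xy≢0 x≢0 y≢0 e = y≢0 (xy≡0⇒y≡0 x≢0 e)

  x*y≡1⇒x≢0 : ∀ {x y} → x * y ≡ 1# → x ≢ 0#
  x*y≡1⇒x≢0 {y = y} e refl = 0≢1 (trans (sym (zeroˡ y)) e)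

  -- Finite sums.

  Σ-cong : ∀ n {f h : Fin n → F} → (∀ i → f i ≡ h i) → Σ[ n ] f ≡ Σ[ n ] h
  Σ-cong zero    e = refl
  Σ-cong (suc n) e = cong₂ _+_ (e Fin.zero) (Σ-cong n (e ∘ Fin.suc))

  Σ-+ : ∀ n (f h : Fin n → F) → Σ[ n ] (λ i → f i + h i) ≡ Σ[ n ] f + Σ[ n ] h
  Σ-+ zero    f h = sym (+-identityˡ 0#)
  Σ-+ (suc n) f h = trans (cong (_ +_) (Σ-+ n (f ∘ Fin.suc) (h ∘ Fin.suc)))
    (solve 4 (λ a b c d → (a :+ b) :+ (c :+ d) := (a :+ c) :+ (b :+ d)) refl _ _ _ _)

  Σ-*ˡ : ∀ n a (f : Fin n → F) → a * Σ[ n ] f ≡ Σ[ n ] (λ i → a * f i)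
  Σ-*ˡ zero    a f = zeroʳ a
  Σ-*ˡ (suc n) a f = trans (distribˡ a _ _) (cong (_ +_) (Σ-*ˡ n a (f ∘ Fin.suc)))

  Σ-last : ∀ n (f : ℕ → F) → Σ[ suc n ] (f ∘ toℕ) ≡ Σ[ n ] (f ∘ toℕ) + f n
  Σ-last zero    f = +-comm (f 0) 0#
  Σ-last (suc n) f = trans (cong (f 0 +_) (Σ-last n (f ∘ suc))) (sym (+-assoc _ _ _))

  Σ-homo : ∀ (φ : F → F) → φ 0# ≡ 0# → (∀ x y → φ (x + y) ≡ φ x + φ y) →
           ∀ n (f : Fin n → F) → φ (Σ[ n ] f) ≡ Σ[ n ] (φ ∘ f)
  Σ-homo φ φ0 φ+ zero    f = φ0
  Σ-homo φ φ0 φ+ (suc n) f = trans (φ+ _ _) (cong (_ +_) (Σ-homo φ φ0 φ+ n (f ∘ Fin.suc)))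

  ι-⟨⟩ : ∀ N (u v : Word N) → ι ⟨ u , v ⟩ ≡ Σ[ N ] (λ j → ι (u j) * ι (v j))
  ι-⟨⟩ zero    u v = refl
  ι-⟨⟩ (suc N) u v = trans (ι-xor (u Fin.zero ∧ v Fin.zero) _)
    (cong₂ _+_ (ι-∧ (u Fin.zero) (v Fin.zero)) (ι-⟨⟩ N (u ∘ Fin.suc) (v ∘ Fin.suc)))

  -- Powers and the Frobenius map.

  ^-+ : ∀ x m n → x ^ (m ℕ.+ n) ≡ x ^ m * x ^ n
  ^-+ x zero    n = sym (*-identityˡ _)
  ^-+ x (suc m) n = trans (cong (x *_) (^-+ x m n)) (sym (*-assoc x _ _))

  *-^ : ∀ x y n → (x * y) ^ n ≡ x ^ n * y ^ n
  *-^ x y zero    = sym (*-identityˡ 1#)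
  *-^ x y (suc n) = trans (cong (x * y *_) (*-^ x y n))
    (solve 4 (λ x y a b → (x :* y) :* (a :* b) := (x :* a) :* (y :* b)) refl x y _ _)

  1^ : ∀ n → 1# ^ n ≡ 1#
  1^ zero    = refl
  1^ (suc n) = trans (*-identityˡ _) (1^ n)

  ^-≢0 : ∀ {x} n → x ≢ 0# → x ^ n ≢ 0#
  ^-≢0 zero    x≢0 = 0≢1 ∘ sym
  ^-≢0 (suc n) x≢0 = xy≢0 x≢0 (^-≢0 n x≢0)

  ^2^-suc : ∀ x i → x ^ (2 ℕ.^ suc i) ≡ x ^ (2 ℕ.^ i) * x ^ (2 ℕ.^ i)
  ^2^-suc x i = trans (cong (λ e → x ^ (2 ℕ.^ i ℕ.+ e)) (ℕ.+-identityʳ _)) (^-+ x (2 ℕ.^ i) (2 ℕ.^ i))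

  -- Iterated Frobenius: each squaring loses its cross term in characteristic 2.
  ^2^-+ : ∀ x y i → (x + y) ^ (2 ℕ.^ i) ≡ x ^ (2 ℕ.^ i) + y ^ (2 ℕ.^ i)
  ^2^-+ x y zero    = solve 2 (λ x y → (x :+ y) :* con true := x :* con true :+ y :* con true) refl x y
  ^2^-+ x y (suc i) = begin
    (x + y) ^ (2 ℕ.^ suc i)                      ≡⟨ ^2^-suc (x + y) i ⟩
    (x + y) ^ (2 ℕ.^ i) * (x + y) ^ (2 ℕ.^ i)    ≡⟨ cong₂ _*_ (^2^-+ x y i) (^2^-+ x y i) ⟩
    (a + b) * (a + b)                            ≡⟨ solve 2 (λ a b → (a :+ b) :* (a :+ b) := a :* a :+ b :* b) refl a b ⟩
    a * a + b * b                                ≡⟨ cong₂ _+_ (^2^-suc x i) (^2^-suc y i) ⟨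
    x ^ (2 ℕ.^ suc i) + y ^ (2 ℕ.^ suc i)        ∎
    where
    a = x ^ (2 ℕ.^ i)
    b = y ^ (2 ℕ.^ i)

  -- The multiplicative group

  units : List F
  units = filter (λ x → ¬? (x ≟ 0#)) elements

  units-unique : Unique units
  units-unique = Unique.filter⁺ _ elements-unique

  ∈-units⁺ : ∀ {x} → x ≢ 0# → x ∈ units
  ∈-units⁺ = ∈-filter⁺ (λ x → ¬? (x ≟ 0#)) (elements-complete _)

  ∈-units⁻ : ∀ {x} → x ∈ units → x ≢ 0#
  ∈-units⁻ = proj₂ ∘ ∈-filter⁻ (λ x → ¬? (x ≟ 0#)) {xs = elements}

  -- Prepending 0 to the units gives a permutation of `elements`; `suc` on the left avoids a
  -- truncated subtraction.
  units-length : suc (length units) ≡ 2 ℕ.^ r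
  units-length = trans (↭-length 0∷units↭elements) elements-size
    where
    0∷units↭elements : (0# ∷ units) ↭ elements
    0∷units↭elements = unique-↭
      (All.tabulate (λ x∈ 0≡x → ∈-units⁻ x∈ (sym 0≡x)) ∷ units-unique) elements-unique
      (λ _ → elements-complete _) zero-or-unit
      where
      zero-or-unit : ∀ {z} → z ∈ elements → z ∈ 0# ∷ units
      zero-or-unit {z} _ with z ≟ 0#
      ... | yes z≡0 = here z≡0
      ... | no  z≢0 = there (∈-units⁺ z≢0)

  product : List F → F
  product = foldr _*_ 1#

  product-↭ : ∀ {xs ys} → xs ↭ ys → product xs ≡ product ys
  product-↭ p = PermutationSetoid.foldr-commMonoid (setoid F) *-isCommutativeMonoid (↭⇒↭ₛ p)

  product-scale : ∀ x ys → product (List.map (x *_) ys) ≡ x ^ length ys * product ys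
  product-scale x []       = sym (*-identityˡ 1#)
  product-scale x (y ∷ ys) = trans (cong (x * y *_) (product-scale x ys))
    (solve 4 (λ x y a b → (x :* y) :* (a :* b) := (x :* a) :* (y :* b)) refl x y _ _)

  product-≢0 : ∀ ys → (∀ {y} → y ∈ ys → y ≢ 0#) → product ys ≢ 0#
  product-≢0 []       h = 0≢1 ∘ sym
  product-≢0 (y ∷ ys) h = xy≢0 (h (here refl)) (product-≢0 ys (h ∘ there))

  scale-units-↭ : ∀ {x} → x ≢ 0# → List.map (x *_) units ↭ units
  scale-units-↭ {x} x≢0 = unique-↭ (Unique.map⁺ (*-cancelˡ _ _ x≢0) units-unique) units-unique to from
    where
    to : ∀ {z} → z ∈ List.map (x *_) units → z ∈ units
    to z∈ with y , y∈ , refl ← ∈-map⁻ (x *_) z∈ = ∈-units⁺ (xy≢0 x≢0 (∈-units⁻ y∈))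
    from : ∀ {z} → z ∈ units → z ∈ List.map (x *_) units
    from {z} z∈ with w , xw≡1 ← inverse x x≢0 = subst (_∈ _) x[wz]≡z (∈-map⁺ (x *_) (∈-units⁺ (xy≢0 w≢0 (∈-units⁻ z∈))))
      where
      w≢0 : w ≢ 0#
      w≢0 = x*y≡1⇒x≢0 (trans (*-comm w x) xw≡1)
      x[wz]≡z : x * (w * z) ≡ z
      x[wz]≡z = trans (sym (*-assoc x w z)) (trans (cong (_* z) xw≡1) (*-identityˡ z))

  -- Multiplication by `x` permutes the units, so their product P satisfies x^|units| · P = P, and P
  -- is nonzero.
  x^|units|≡1 : ∀ {x} → x ≢ 0# → x ^ length units ≡ 1#
  x^|units|≡1 {x} x≢0 = *-cancelˡ _ _ (product-≢0 units ∈-units⁻) (begin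
    product units * x ^ length units  ≡⟨ *-comm _ _ ⟩
    x ^ length units * product units  ≡⟨ product-scale x units ⟨
    product (List.map (x *_) units)   ≡⟨ product-↭ (scale-units-↭ x≢0) ⟩
    product units                     ≡⟨ *-identityʳ _ ⟨
    product units * 1#                ∎)

  x^q≡x : ∀ x → x ^ (2 ℕ.^ r) ≡ x
  x^q≡x x = trans (cong (x ^_) (sym units-length)) x^[1+|units|]≡x
    where
    x^[1+|units|]≡x : x * x ^ length units ≡ x
    x^[1+|units|]≡x with x ≟ 0#
    ... | yes refl = zeroˡ _
    ... | no  x≢0  = trans (cong (x *_) (x^|units|≡1 x≢0)) (*-identityʳ x)

  -- The absolute trace

  tr-+ : ∀ x y → tr (x + y) ≡ tr x + tr y
  tr-+ x y = trans (Σ-cong r (λ i → ^2^-+ x y (toℕ i))) (Σ-+ r _ _)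

  tr-0 : tr 0# ≡ 0#
  tr-0 = begin
    tr 0#          ≡⟨ cong tr (x+x≡0 0#) ⟨
    tr (0# + 0#)   ≡⟨ tr-+ 0# 0# ⟩
    tr 0# + tr 0#  ≡⟨ x+x≡0 _ ⟩
    0#             ∎

  -- Squaring sends each term x^(2^i) to the next one, and x^q = x closes the cycle. Hence tr x is 0
  -- or 1, so `toF2` loses no information on traces.
  tr-idem : ∀ x → tr x * tr x ≡ tr x
  tr-idem x = begin
    tr x * tr x                                ≡⟨ Σ-homo (λ z → z * z) (zeroˡ 0#) square-+ r _ ⟩
    Σ[ r ] (λ i → f (toℕ i) * f (toℕ i))       ≡⟨ Σ-cong r (λ i → sym (^2^-suc x (toℕ i))) ⟩
    -- Adding `f 0` twice changes nothing in characteristic 2; one copy completes the shifted sum to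
    -- one over 0 ≤ i ≤ r, whose last term can then be split off.
    Σ[ r ] (λ i → f (suc (toℕ i)))             ≡⟨ solve 2 (λ a s → s := a :+ (a :+ s)) refl (f 0) _ ⟩
    f 0 + Σ[ suc r ] (f ∘ toℕ)                 ≡⟨ cong (f 0 +_) (Σ-last r f) ⟩
    f 0 + (tr x + f r)                         ≡⟨ cong₂ (λ a b → a + (tr x + b)) (*-identityʳ x) (x^q≡x x) ⟩
    x + (tr x + x)                             ≡⟨ solve 2 (λ x t → x :+ (t :+ x) := t) refl x (tr x) ⟩
    tr x                                       ∎
    where
    f : ℕ → F
    f i = x ^ (2 ℕ.^ i)
    square-+ : ∀ a b → (a + b) * (a + b) ≡ a * a + b * b
    square-+ = solve 2 (λ a b → (a :+ b) :* (a :+ b) := a :* a :+ b :* b) refl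

  -- The only idempotents of a field are 0 and 1.
  ι-toF2 : ∀ z → z * z ≡ z → ι (toF2 z) ≡ z
  ι-toF2 z e with z ≟ 0#
  ... | yes z≡0 = sym z≡0
  ... | no  z≢0 = sym (*-cancelˡ z 1# z≢0 (trans e (sym (*-identityʳ z))))

  ι-toF2-tr : ∀ x → ι (toF2 (tr x)) ≡ tr x
  ι-toF2-tr x = ι-toF2 (tr x) (tr-idem x)

  toF2-tr-+ : ∀ x y → toF2 (tr (x + y)) ≡ toF2 (tr x) xor toF2 (tr y)
  toF2-tr-+ x y = ι-injective _ _ (begin
    ι (toF2 (tr (x + y)))                 ≡⟨ ι-toF2-tr (x + y) ⟩
    tr (x + y)                            ≡⟨ tr-+ x y ⟩
    tr x + tr y                           ≡⟨ cong₂ _+_ (ι-toF2-tr x) (ι-toF2-tr y) ⟨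
    ι (toF2 (tr x)) + ι (toF2 (tr y))     ≡⟨ ι-xor (toF2 (tr x)) (toF2 (tr y)) ⟨
    ι (toF2 (tr x) xor toF2 (tr y))       ∎)

  -- Polynomials as coefficient vectors, lowest degree first

  eval : ∀ {n} → Vec F n → F → F
  eval []      x = 0#
  eval (c ∷ p) x = c + x * eval p x

  -- Horner's scheme: dividing by x - a, the coefficients of the quotient are the values at `a` of
  -- the successive tails.
  quotient : ∀ {n} → F → Vec F (suc n) → Vec F n
  quotient a (_ ∷ [])    = []
  quotient a (_ ∷ d ∷ p) = eval (d ∷ p) a ∷ quotient a (d ∷ p)

  eval-quotient : ∀ {n} a (p : Vec F (suc n)) x → eval p x ≡ eval p a + (x + a) * eval (quotient a p) x
  eval-quotient a (c ∷ [])    x =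
    solve 3 (λ c x a → c :+ x :* con false := (c :+ a :* con false) :+ (x :+ a) :* con false) refl c x a
  eval-quotient a (c ∷ d ∷ p) x = begin
    c + x * eval (d ∷ p) x                        ≡⟨ cong (λ e → c + x * e) (eval-quotient a (d ∷ p) x) ⟩
    c + x * (e + (x + a) * s)                     ≡⟨ solve 5 (λ c x a e s → c :+ x :* (e :+ (x :+ a) :* s)
                                                       := (c :+ a :* e) :+ (x :+ a) :* (e :+ x :* s)) refl c x a e s ⟩
    (c + a * e) + (x + a) * (e + x * s)           ∎
    where
    e = eval (d ∷ p) a
    s = eval (quotient a (d ∷ p)) x

  -- A vector of length `n` has degree below `n`. Each root `a` splits off a factor x + a = x - a,
  -- and the other roots pass to the quotient because they differ from `a`.
  many-roots⇒zero : ∀ {n} (p : Vec F n) {xs} → Unique xs → n ≤ length xs →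
                    All (λ x → eval p x ≡ 0#) xs → ∀ x → eval p x ≡ 0#
  many-roots⇒zero {zero}  []  _ _ _ x = refl
  many-roots⇒zero {suc n} p {a ∷ xs} (a∉xs ∷ u) (s≤s n≤) (pa≡0 ∷ roots) x = begin
    eval p x                                       ≡⟨ eval-quotient a p x ⟩
    eval p a + (x + a) * eval (quotient a p) x     ≡⟨ cong₂ (λ s t → s + (x + a) * t) pa≡0
                                                        (many-roots⇒zero (quotient a p) u n≤ (All.zipWith root (a∉xs , roots)) x) ⟩
    0# + (x + a) * 0#                              ≡⟨ solve 1 (λ y → con false :+ y :* con false := con false) refl (x + a) ⟩
    0#                                             ∎
    where
    root : ∀ {y} → (a ≢ y) × (eval p y ≡ 0#) → eval (quotient a p) y ≡ 0#
    root {y} (a≢y , py≡0) = xy≡0⇒y≡0 (λ y+a≡0 → a≢y (sym (x+y≡0⇒x≡y y+a≡0))) (begin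
      (y + a) * eval (quotient a p) y              ≡⟨ +-identityˡ _ ⟨
      0# + (y + a) * eval (quotient a p) y         ≡⟨ cong (_+ (y + a) * eval (quotient a p) y) pa≡0 ⟨
      eval p a + (y + a) * eval (quotient a p) y   ≡⟨ eval-quotient a p y ⟨
      eval p y                                     ≡⟨ py≡0 ⟩
      0#                                           ∎)

  -- Polynomial functions of degree at most `n` with zero constant term. Keeping the factor x apart
  -- lets a constant be put in front without changing the other coefficients.
  Poly₀ : ℕ → (F → F) → Set
  Poly₀ n f = Σ (Vec F n) λ p → ∀ x → f x ≡ x * eval p x

  poly₀-zero : ∀ n → Poly₀ n (λ _ → 0#)
  poly₀-zero n = Vec.replicate n 0# , λ x → sym (trans (cong (x *_) (eval-0 n x)) (zeroʳ x))
    where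
    eval-0 : ∀ n x → eval (Vec.replicate n 0#) x ≡ 0#
    eval-0 zero    x = refl
    eval-0 (suc n) x = trans (+-identityˡ _) (trans (cong (x *_) (eval-0 n x)) (zeroʳ x))

  poly₀-+ : ∀ {n f h} → Poly₀ n f → Poly₀ n h → Poly₀ n (λ x → f x + h x)
  poly₀-+ (p , fp) (s , hs) = Vec.zipWith _+_ p s , λ x →
    trans (cong₂ _+_ (fp x) (hs x)) (trans (sym (distribˡ x _ _)) (cong (x *_) (sym (eval-+ p s x))))
    where
    eval-+ : ∀ {n} (p s : Vec F n) x → eval (Vec.zipWith _+_ p s) x ≡ eval p x + eval s x
    eval-+ []      []      x = sym (+-identityˡ 0#)
    eval-+ (c ∷ p) (d ∷ s) x = trans (cong (λ e → (c + d) + x * e) (eval-+ p s x))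
      (solve 5 (λ c d x a b → (c :+ d) :+ x :* (a :+ b) := (c :+ x :* a) :+ (d :+ x :* b)) refl c d x _ _)

  poly₀-scale : ∀ {n f} a → Poly₀ n f → Poly₀ n (λ x → a * f x)
  poly₀-scale {f = f} a (p , fp) = Vec.map (a *_) p , λ x → begin
    a * f x              ≡⟨ cong (a *_) (fp x) ⟩
    a * (x * eval p x)   ≡⟨ solve 3 (λ a x e → a :* (x :* e) := x :* (a :* e)) refl a x _ ⟩
    x * (a * eval p x)   ≡⟨ cong (x *_) (eval-scale p x) ⟨
    x * eval (Vec.map (a *_) p) x ∎
    where
    eval-scale : ∀ {n} (p : Vec F n) x → eval (Vec.map (a *_) p) x ≡ a * eval p x
    eval-scale []      x = sym (zeroʳ a)
    eval-scale (c ∷ p) x = trans (cong (λ e → a * c + x * e) (eval-scale p x))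
      (solve 4 (λ a c x e → a :* c :+ x :* (a :* e) := a :* (c :+ x :* e)) refl a c x _)

  poly₀-^ : ∀ {n k} → 0 < k → k ≤ n → Poly₀ n (_^ k)
  poly₀-^ {suc n} {suc zero}    _ _          with p , e ← poly₀-zero n =
    1# ∷ p , λ x → cong (x *_) (trans (sym (+-identityʳ 1#)) (cong (1# +_) (e x)))
  poly₀-^ {suc n} {suc (suc k)} _ (s≤s k<n) with p , e ← poly₀-^ {n} {suc k} (s≤s z≤n) k<n =
    0# ∷ p , λ x → cong (x *_) (trans (e x) (sym (+-identityˡ _)))

  poly₀-Σ : ∀ {n} m {f : Fin m → F → F} → (∀ i → Poly₀ n (f i)) → Poly₀ n (λ x → Σ[ m ] (λ i → f i x))
  poly₀-Σ zero    _ = poly₀-zero _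
  poly₀-Σ (suc m) h = poly₀-+ (h Fin.zero) (poly₀-Σ m (h ∘ Fin.suc))

  -- The polynomial c + f has n + 1 ≤ q - 1 coefficients and all q - 1 units as roots, so it
  -- vanishes at 0 as well, where its value is `c`.
  constant-term≡0 : ∀ {n f} c → Poly₀ n f → suc n < 2 ℕ.^ r → (∀ x → x ≢ 0# → c + f x ≡ 0#) → c ≡ 0#
  constant-term≡0 {n} c (p , fp) n< h = trans
    (solve 2 (λ c e → c := c :+ con false :* e) refl c (eval p 0#))
    (many-roots⇒zero (c ∷ p) units-unique (ℕ.≤-pred (subst (suc n <_) (sym units-length) n<))
      (All.tabulate (λ {x} x∈ → trans (cong (c +_) (sym (fp x))) (h x (∈-units⁻ x∈)))) 0#)

  -- Linear functionals

  -- Linearity in the form that elimination uses: a multiple of one fixed word `w` is added.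
  ⟨⟩-linear : ∀ N (u v w : Word N) s → ⟨ u , (λ j → v j xor (s ∧ w j)) ⟩ ≡ ⟨ u , v ⟩ xor (s ∧ ⟨ u , w ⟩)
  ⟨⟩-linear zero    u v w s = sym (Bool.∧-zeroʳ s)
  ⟨⟩-linear (suc N) u v w s = trans
    (cong ((u Fin.zero ∧ (v Fin.zero xor (s ∧ w Fin.zero))) xor_) (⟨⟩-linear N (u ∘ Fin.suc) (v ∘ Fin.suc) (w ∘ Fin.suc) s))
    (B.solve 6 (λ u v w s a b → (u B.:* (v B.:+ (s B.:* w))) B.:+ (a B.:+ (s B.:* b))
       B.:= ((u B.:* v) B.:+ a) B.:+ (s B.:* ((u B.:* w) B.:+ b)))
       refl (u Fin.zero) (v Fin.zero) (w Fin.zero) s ⟨ u ∘ Fin.suc , v ∘ Fin.suc ⟩ ⟨ u ∘ Fin.suc , w ∘ Fin.suc ⟩)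
    where module B = xor-∧-Solver

  ⟨⟩-zeroˡ : ∀ N (v : Word N) → ⟨ (λ _ → false) , v ⟩ ≡ false
  ⟨⟩-zeroˡ zero    v = refl
  ⟨⟩-zeroˡ (suc N) v = ⟨⟩-zeroˡ N (v ∘ Fin.suc)

  Additive : (F → Bool) → Set
  Additive φ = ∀ x y → φ (x + y) ≡ φ x xor φ y

  -- The system φ_j(a) = v_j over 𝔽₂; an obstruction is a sum of some of its equations that reads 0
  -- = 1.
  Solvable Obstructed : ∀ {N} → (Fin N → F → Bool) → Word N → Set
  Solvable   φ v = ∃ λ a → ∀ j → φ j a ≡ v j
  Obstructed φ v = ∃ λ u → (∀ a → ⟨ u , (λ j → φ j a) ⟩ ≡ false) × ⟨ u , v ⟩ ≡ true

  -- When φ₀ b = 1, the first equation is eliminated by composing the others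
  -- with the projection x ↦ x + φ₀(x) b onto the kernel of φ₀.
  fredholm : ∀ N (φ : Fin N → F → Bool) → (∀ j → Additive (φ j)) → (v : Word N) → Solvable φ v ⊎ Obstructed φ v
  fredholm zero    φ φ+ v = inj₁ (0# , λ ())
  fredholm (suc N) φ φ+ v with any? (λ b → φ Fin.zero b Bool.≟ true) elements
  -- Here φ₀ is the zero functional and the first equation reads 0 = v₀: an obstruction by itself if
  -- v₀ = 1, and dropped if v₀ = 0.
  ... | no ∄b = trivial (v Fin.zero) refl
    where
    φ₀≡0 : ∀ x → φ Fin.zero x ≡ false
    φ₀≡0 x = Bool.¬-not (λ e → ∄b (lose (elements-complete x) e))

    trivial : ∀ v₀ → v Fin.zero ≡ v₀ → Solvable φ v ⊎ Obstructed φ v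
    trivial true v₀≡1 = inj₂ (u , (λ a → cong₂ _xor_ (φ₀≡0 a) (⟨⟩-zeroˡ N (λ j → φ (Fin.suc j) a)))
                                 , cong₂ _xor_ v₀≡1 (⟨⟩-zeroˡ N (v ∘ Fin.suc)))
      where
      u : Word (suc N)
      u Fin.zero    = true
      u (Fin.suc j) = false
    trivial false v₀≡0 with fredholm N (φ ∘ Fin.suc) (φ+ ∘ Fin.suc) (v ∘ Fin.suc)
    ... | inj₁ (a , e) = inj₁ (a , λ { Fin.zero → trans (φ₀≡0 a) (sym v₀≡0) ; (Fin.suc j) → e j })
    ... | inj₂ (u , uφ≡0 , uv≡1) = inj₂ ((λ { Fin.zero → false ; (Fin.suc j) → u j }) , uφ≡0 , uv≡1)
  ... | yes ∃b with find ∃b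
  ... | b , _ , φ₀b≡1 = eliminate (fredholm N φ′ φ′+ v′)
    where
    module B = xor-∧-Solver
    φ₀ : F → Bool
    φ₀ = φ Fin.zero
    v₀ : Bool
    v₀ = v Fin.zero
    w : Word N
    w j = φ (Fin.suc j) b
    φ′ : Fin N → F → Bool
    φ′ j x = φ (Fin.suc j) x xor (φ₀ x ∧ w j)
    v′ : Word N
    v′ j = v (Fin.suc j) xor (v₀ ∧ w j)

    φ′+ : ∀ j → Additive (φ′ j)
    φ′+ j x y = trans (cong₂ (λ s t → s xor (t ∧ w j)) (φ+ (Fin.suc j) x y) (φ+ Fin.zero x y))
      (B.solve 5 (λ p q s t w → (p B.:+ q) B.:+ ((s B.:+ t) B.:* w) B.:= (p B.:+ (s B.:* w)) B.:+ (q B.:+ (t B.:* w)))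
        refl (φ (Fin.suc j) x) (φ (Fin.suc j) y) (φ₀ x) (φ₀ y) (w j))

    φ-ι* : ∀ j s → φ j (ι s * b) ≡ s ∧ φ j b
    φ-ι* j true  = cong (φ j) (*-identityˡ b)
    φ-ι* j false = begin
      φ j (0# * b)       ≡⟨ cong (φ j) (trans (zeroˡ b) (sym (x+x≡0 0#))) ⟩
      φ j (0# + 0#)      ≡⟨ φ+ j 0# 0# ⟩
      φ j 0# xor φ j 0#  ≡⟨ Bool.xor-same (φ j 0#) ⟩
      false              ∎

    eliminate : Solvable φ′ v′ ⊎ Obstructed φ′ v′ → Solvable φ v ⊎ Obstructed φ v
    -- Adding `b` exactly when `a` fails the first equation repairs it; `φ′` and `v′` are made so
    -- that the other equations then hold too.
    eliminate (inj₁ (a , e)) = inj₁ (a + ι s * b , solution)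
      where
      s = φ₀ a xor v₀
      φ-a : ∀ j → φ j (a + ι s * b) ≡ φ j a xor (s ∧ φ j b)
      φ-a j = trans (φ+ j a (ι s * b)) (cong (φ j a xor_) (φ-ι* j s))
      solution : ∀ j → φ j (a + ι s * b) ≡ v j
      solution Fin.zero    = trans (φ-a Fin.zero) (trans (cong (λ t → φ₀ a xor (s ∧ t)) φ₀b≡1)
        (B.solve 2 (λ p v → p B.:+ ((p B.:+ v) B.:* B.con true) B.:= v) refl (φ₀ a) v₀))
      solution (Fin.suc j) = begin
        φ (Fin.suc j) (a + ι s * b)                ≡⟨ φ-a (Fin.suc j) ⟩
        φ (Fin.suc j) a xor (s ∧ w j)              ≡⟨ B.solve 4 (λ x p v w → x B.:+ ((p B.:+ v) B.:* w)
                                                        B.:= (x B.:+ (p B.:* w)) B.:+ (v B.:* w)) refl (φ (Fin.suc j) a) (φ₀ a) v₀ (w j) ⟩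
        φ′ j a xor (v₀ ∧ w j)                      ≡⟨ cong (_xor (v₀ ∧ w j)) (e j) ⟩
        v′ j xor (v₀ ∧ w j)                        ≡⟨ B.solve 2 (λ x y → (x B.:+ y) B.:+ y B.:= x) refl (v (Fin.suc j)) (v₀ ∧ w j) ⟩
        v (Fin.suc j)                              ∎
    eliminate (inj₂ (u , uφ′≡0 , uv′≡1)) = inj₂ (u′ , (λ a → trans (pairing (λ j → φ j a)) (uφ′≡0 a)) , trans (pairing v) uv′≡1)
      where
      u′ : Word (suc N)
      -- This coefficient makes pairing with `u′` agree with pairing `u` against the eliminated
      -- word. It applies to the left-hand sides and to `v` alike.
      u′ Fin.zero    = ⟨ u , w ⟩
      u′ (Fin.suc j) = u j
      pairing : ∀ v → ⟨ u′ , v ⟩ ≡ ⟨ u , (λ j → v (Fin.suc j) xor (v Fin.zero ∧ w j)) ⟩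
      pairing v = trans (B.solve 3 (λ p q v → (p B.:* v) B.:+ q B.:= q B.:+ (v B.:* p)) refl ⟨ u , w ⟩ _ (v Fin.zero))
        (sym (⟨⟩-linear N u (v ∘ Fin.suc) w (v Fin.zero)))

  tr-ι : ∀ b a t → tr (a * (ι b * t)) ≡ ι b * tr (a * t)
  tr-ι true  a t = trans (cong (λ z → tr (a * z)) (*-identityˡ t)) (sym (*-identityˡ _))
  tr-ι false a t = trans (cong tr (trans (cong (a *_) (zeroˡ t)) (zeroʳ a))) (trans tr-0 (sym (zeroˡ _)))

  Tr-cong : ∀ {m} {g h : Mat m} → g ≐ h → Tr g ≡ Tr h
  Tr-cong {m} e = Σ-cong m (λ i → e i i)

  -- Orthogonal matrices with prescribed trace

  diagonal : F → F → Mat 2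
  diagonal x y 0F 0F = x
  diagonal x y 0F 1F = 0#
  diagonal x y 1F 0F = 0#
  diagonal x y 1F 1F = y

  diagonal-inverse : ∀ x y → x * y ≡ 1# → (diagonal x y ⊗ diagonal y x) ≐ idM
  diagonal-inverse x y e 0F 0F = trans (solve 2 (λ x y → x :* y :+ (con false :* con false :+ con false) := x :* y) refl x y) e
  diagonal-inverse x y e 0F 1F = solve 1 (λ x → x :* con false :+ (con false :* x :+ con false) := con false) refl x
  diagonal-inverse x y e 1F 0F = solve 1 (λ y → con false :* y :+ (y :* con false :+ con false) := con false) refl y
  diagonal-inverse x y e 1F 1F = trans (solve 2 (λ x y → con false :* con false :+ (y :* x :+ con false) := x :* y) refl x y) e

  -- The form is scaled by xy = 1, and δ⁺ vanishes because the off-diagonal blocks B and C are zero.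
  diagonal∈SO⁺ : ∀ x y → x * y ≡ 1# → SO⁺ 1 (diagonal x y)
  diagonal∈SO⁺ x y e =
    ( (diagonal y x , diagonal-inverse x y e , diagonal-inverse y x (trans (*-comm y x) e))
    , λ z → trans
        (solve 4 (λ x y a b → (x :* a :+ (con false :* b :+ con false)) :* (con false :* a :+ (y :* b :+ con false)) :+ con false
           := (x :* y) :* (a :* b) :+ con false) refl x y (z 0F) (z 1F))
        (cong (_+ 0#) (trans (cong (_* (z 0F * z 1F)) e) (*-identityˡ _))))
    , solve 0 ((con false :* con false :+ con false) :+ con false := con false) refl

  -- Syntactic counterpart of `Σ[ n ]`, unfolding in the same way, so that matrix identities can be
  -- handed to the solver.
  Σₚ : ∀ {k} n → (Fin n → Polynomial k) → Polynomial k
  Σₚ zero    f = con false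
  Σₚ (suc n) f = f Fin.zero :+ Σₚ n (f ∘ Fin.suc)

  -- Writing (x₀,x₁,x₂,x₃) as the matrix X = [[x₀,x₁],[x₃,x₂]] turns θ⁺ into det X; this is
  -- X ↦ [[1,1],[1,0]] X [[t,1],[1,0]], whose trace is the product 1 · t of the traces.
  twistOver : {A : Set} → A → A → A → Fin 4 → Fin 4 → A
  twistOver o i t = Vec.lookup ∘ Vec.lookup
    ( (t ∷ i ∷ i ∷ t ∷ [])
    ∷ (i ∷ o ∷ o ∷ i ∷ [])
    ∷ (i ∷ o ∷ o ∷ o ∷ [])
    ∷ (t ∷ i ∷ o ∷ o ∷ []) ∷ [])

  -- The inverse map X ↦ [[0,1],[1,1]] X [[0,1],[1,t]]. The entry type is a parameter so that one
  -- table serves both field elements and solver polynomials.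
  untwistOver : {A : Set} → A → A → A → Fin 4 → Fin 4 → A
  untwistOver o i t = Vec.lookup ∘ Vec.lookup
    ( (o ∷ o ∷ i ∷ o ∷ [])
    ∷ (o ∷ o ∷ t ∷ i ∷ [])
    ∷ (i ∷ t ∷ t ∷ i ∷ [])
    ∷ (o ∷ i ∷ i ∷ o ∷ []) ∷ [])

  twist untwist : F → Mat 4
  twist   = twistOver 0# 1#
  untwist = untwistOver 0# 1#

  twistₚ untwistₚ : ∀ {k} → Fin 4 → Fin 4 → Polynomial (suc k)
  twistₚ   = twistOver (con false) (con true) (var Fin.zero)
  untwistₚ = untwistOver (con false) (con true) (var Fin.zero)

  idₚ : Fin 4 → Fin 4 → Polynomial 1
  idₚ i j = con (does (i Fin.≟ j))

  twist-untwist : ∀ t → (twist t ⊗ untwist t) ≐ idM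
  twist-untwist t = entries
    where
    entry : ∀ i j → _
    entry i j = prove (t ∷ []) (Σₚ 4 (λ k → twistₚ i k :* untwistₚ k j)) (idₚ i j)
    -- The tables and `idM` reduce only at concrete indices, hence one `refl` per entry.
    entries : (twist t ⊗ untwist t) ≐ idM
    entries 0F 0F = entry 0F 0F refl
    entries 0F 1F = entry 0F 1F refl
    entries 0F 2F = entry 0F 2F refl
    entries 0F 3F = entry 0F 3F refl
    entries 1F 0F = entry 1F 0F refl
    entries 1F 1F = entry 1F 1F refl
    entries 1F 2F = entry 1F 2F refl
    entries 1F 3F = entry 1F 3F refl
    entries 2F 0F = entry 2F 0F refl
    entries 2F 1F = entry 2F 1F refl
    entries 2F 2F = entry 2F 2F refl
    entries 2F 3F = entry 2F 3F refl
    entries 3F 0F = entry 3F 0F refl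
    entries 3F 1F = entry 3F 1F refl
    entries 3F 2F = entry 3F 2F refl
    entries 3F 3F = entry 3F 3F refl

  untwist-twist : ∀ t → (untwist t ⊗ twist t) ≐ idM
  untwist-twist t = entries
    where
    entry : ∀ i j → _
    entry i j = prove (t ∷ []) (Σₚ 4 (λ k → untwistₚ i k :* twistₚ k j)) (idₚ i j)
    entries : (untwist t ⊗ twist t) ≐ idM
    entries 0F 0F = entry 0F 0F refl
    entries 0F 1F = entry 0F 1F refl
    entries 0F 2F = entry 0F 2F refl
    entries 0F 3F = entry 0F 3F refl
    entries 1F 0F = entry 1F 0F refl
    entries 1F 1F = entry 1F 1F refl
    entries 1F 2F = entry 1F 2F refl
    entries 1F 3F = entry 1F 3F refl
    entries 2F 0F = entry 2F 0F refl
    entries 2F 1F = entry 2F 1F refl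
    entries 2F 2F = entry 2F 2F refl
    entries 2F 3F = entry 2F 3F refl
    entries 3F 0F = entry 3F 0F refl
    entries 3F 1F = entry 3F 1F refl
    entries 3F 2F = entry 3F 2F refl
    entries 3F 3F = entry 3F 3F refl

  -- Both 2 × 2 factors have determinant 1 in characteristic 2, so det X is preserved. In δ⁺ two
  -- products 1 · 1 survive and cancel.
  twist∈SO⁺ : ∀ t → SO⁺ 2 (twist t)
  twist∈SO⁺ t =
    ( (untwist t , twist-untwist t , untwist-twist t)
    , λ z → prove (t ∷ z 0F ∷ z 1F ∷ z 2F ∷ z 3F ∷ []) (θₚ (λ i → Σₚ 4 (λ k → twistₚ i k :* var (Fin.suc k)))) (θₚ (var ∘ Fin.suc)) refl)
    , prove (t ∷ []) (Σₚ 2 (λ i → Σₚ 2 (λ j → twistₚ (i Fin.↑ˡ 2) (2 Fin.↑ʳ j) :* twistₚ (2 Fin.↑ʳ i) (j Fin.↑ˡ 2)))) (con false) refl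
    where
    θₚ : ∀ {k} → (Fin 4 → Polynomial k) → Polynomial k
    θₚ x = Σₚ 2 (λ i → x (i Fin.↑ˡ 2) :* x (2 Fin.↑ʳ i))

  Tr-twist : ∀ t → Tr (twist t) ≡ t
  Tr-twist = solve 1 (λ t → t :+ (con false :+ (con false :+ (con false :+ con false))) := t) refl

-- Nondegeneracy of the trace form.

module TraceCode {R : ℕ} (K : FiniteField2 (suc R)) where
  open Over K
  open FieldProperties K
  open FieldProperties.Solver K using (solve; con; _:=_; _:+_; _:*_)
  open ≡-Reasoning

  -- For x ≠ 0 the quotient tr(x)/x is a polynomial in x with constant term 1 and degree below q − 1.
  tr-nonzero : ¬ (∀ x → tr x ≡ 0#)
  tr-nonzero tr≡0 = 0≢1 (sym (constant-term≡0 1# f-poly bound vanishes))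
    where
    f : F → F
    f x = Σ[ R ] (λ i → x ^ (2 ℕ.^ suc (toℕ i) ℕ.∸ 1))

    f-poly : Poly₀ (2 ℕ.^ R ℕ.∸ 1) f
    f-poly = poly₀-Σ R (λ i → poly₀-^
      (ℕ.∸-monoˡ-≤ 1 (2^-mono-≤ {1} {suc (toℕ i)} (s≤s z≤n)))
      (ℕ.∸-monoˡ-≤ 1 (2^-mono-≤ (toℕ<n i))))

    suc-pred-2^ : ∀ n → suc (2 ℕ.^ n ℕ.∸ 1) ≡ 2 ℕ.^ n
    suc-pred-2^ n = ℕ.m+[n∸m]≡n (ℕ.m^n>0 2 n)

    -- The degree plus one is q/2, below q. This includes R = 0, where `f` is an empty sum and tr is
    -- the identity.
    bound : suc (2 ℕ.^ R ℕ.∸ 1) < 2 ℕ.^ suc R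
    bound = subst (_< 2 ℕ.^ suc R) (sym (suc-pred-2^ R)) (2^-mono-< (ℕ.n<1+n R))

    vanishes : ∀ x → x ≢ 0# → 1# + f x ≡ 0#
    vanishes x x≢0 = xy≡0⇒y≡0 x≢0 (begin
      x * (1# + f x)    ≡⟨ distribˡ x 1# (f x) ⟩
      x * 1# + x * f x  ≡⟨ cong (x * 1# +_) (trans (Σ-*ˡ R x _) (Σ-cong R (λ i → cong (x ^_) (suc-pred-2^ (suc (toℕ i)))))) ⟩
      tr x              ≡⟨ tr≡0 x ⟩
      0#                ∎)

  -- For s ≠ 0 the products a · s run through the whole field, so tr would vanish identically.
  tr-nondegenerate : ∀ s → (∀ a → tr (a * s) ≡ 0#) → s ≡ 0#
  tr-nondegenerate s h with s ≟ 0#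
  ... | yes s≡0 = s≡0
  ... | no  s≢0 with w , sw≡1 ← inverse s s≢0 = ⊥-elim (tr-nonzero λ x → begin
    tr x              ≡⟨ cong tr (*-identityʳ x) ⟨
    tr (x * 1#)       ≡⟨ cong (λ z → tr (x * z)) sw≡1 ⟨
    tr (x * (s * w))  ≡⟨ cong tr (solve 3 (λ x s w → x :* (s :* w) := (x :* w) :* s) refl x s w) ⟩
    tr ((x * w) * s)  ≡⟨ h (x * w) ⟩
    0#                ∎)

  -- The map a ↦ c(a) into the dual code.

  Separating : ∀ {m} {G : Mat m → Set} → Listing m G → Set
  Separating L = ∀ d → (∀ j → tr (d * Tr (Listing.g L j)) ≡ 0#) → d ≡ 0#

  module _ {m : ℕ} {G : Mat m → Set} (L : Listing m G) where
    open Listing L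

    -- The bits of `u` lie in 𝔽₂, so they pass through the additive map tr.
    ι-⟨⟩-c : ∀ u a → ι ⟨ u , c L a ⟩ ≡ tr (a * Σ[ N ] (λ j → ι (u j) * Tr (g j)))
    ι-⟨⟩-c u a = begin
      ι ⟨ u , c L a ⟩                                    ≡⟨ ι-⟨⟩ N u (c L a) ⟩
      Σ[ N ] (λ j → ι (u j) * ι (c L a j))               ≡⟨ Σ-cong N (λ j → trans (cong (ι (u j) *_) (ι-toF2-tr _)) (sym (tr-ι (u j) a _))) ⟩
      Σ[ N ] (λ j → tr (a * (ι (u j) * Tr (g j))))       ≡⟨ Σ-homo tr tr-0 tr-+ N _ ⟨
      tr (Σ[ N ] (λ j → a * (ι (u j) * Tr (g j))))       ≡⟨ cong tr (Σ-*ˡ N a _) ⟨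
      tr (a * Σ[ N ] (λ j → ι (u j) * Tr (g j)))         ∎

    c-dual : ∀ a → C⊥ L (c L a)
    c-dual a u u∈C = ι-injective _ false (trans (ι-⟨⟩-c u a) (trans (cong tr (trans (cong (a *_) u∈C) (zeroʳ a))) tr-0))

    c-+ : ∀ a b → c L (a + b) ≗w (λ j → c L a j xor c L b j)
    c-+ a b j = trans (cong (toF2 ∘ tr) (distribʳ _ a b)) (toF2-tr-+ _ _)

    -- `Separating` says that the kernel of `c` is trivial, and a + b = a - b lies in that kernel.
    c-injective : Separating L → ∀ a b → c L a ≗w c L b → a ≡ b
    c-injective sep a b e = x+y≡0⇒x≡y (sep (a + b) λ j → begin
      tr ((a + b) * Tr (g j))    ≡⟨ ι-toF2-tr _ ⟨
      ι (c L (a + b) j)          ≡⟨ cong ι (c-+ a b j) ⟩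
      ι (c L a j xor c L b j)    ≡⟨ cong (λ z → ι (z xor c L b j)) (e j) ⟩
      ι (c L b j xor c L b j)    ≡⟨ cong ι (Bool.xor-same (c L b j)) ⟩
      0#                         ∎)

    c-surjective : ∀ v → C⊥ L v → ∃ λ a → c L a ≗w v
    c-surjective v v∈C⊥ with fredholm N (λ j a → c L a j) (λ j a b → c-+ a b j) v
    ... | inj₁ solution = solution
    ... | inj₂ (u , uc≡0 , uv≡1) with () ← trans (sym uv≡1) (v∈C⊥ u (tr-nondegenerate _ λ a → trans (sym (ι-⟨⟩-c u a)) (cong ι (uc≡0 a))))

    separating⇒iso : Separating L → IsIsoOntoDual L
    separating⇒iso sep = c-dual , c-+ , c-injective sep , c-surjective

    -- Transfers the hypothesis from the listed matrices to any member of `G`, which a listing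
    -- contains up to entrywise equality.
    listed-trace : ∀ {d} → (∀ j → tr (d * Tr (g j)) ≡ 0#) → ∀ h → G h → tr (d * Tr h) ≡ 0#
    listed-trace {d} e h h∈G with j , gj≐h ← complete h h∈G = trans (cong (λ z → tr (d * z)) (sym (Tr-cong gj≐h))) (e j)

  -- Multiplying tr(dx) + tr(d/x) by x^(q/2), and using x^q = x, gives for r ≥ 3 a polynomial in x
  -- of degree q/2 + q/4 < q − 1 with constant term d^(q/2), which vanishes at all x ≠ 0.
  tr-x+1/x : 2 ≤ R → ∀ d → (∀ x y → x * y ≡ 1# → tr (d * (x + y)) ≡ 0#) → d ≡ 0#
  tr-x+1/x 2≤R d h with d ≟ 0#
  ... | yes d≡0 = d≡0
  ... | no  d≢0 = ⊥-elim (^-≢0 M d≢0 (constant-term≡0 (D R) f-poly bound vanishes))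
    where
    -- With q = 2^(R+1), `M` is q/2 and `H` is q/4.
    M H : ℕ
    M = 2 ℕ.^ R
    H = 2 ℕ.^ ℕ.pred R

    1+predR : suc (ℕ.pred R) ≡ R
    1+predR = ℕ.suc-pred R {{ℕ.>-nonZero (ℕ.≤-trans (s≤s z≤n) 2≤R)}}

    M≡H+H : M ≡ H ℕ.+ H
    M≡H+H = trans (cong (2 ℕ.^_) (sym 1+predR)) (2^suc (ℕ.pred R))

    2^i≤H : ∀ {i} → i < R → 2 ℕ.^ i ≤ H
    2^i≤H {i} i<R = 2^-mono-≤ (ℕ.≤-pred (subst (i <_) (sym 1+predR) i<R))

    -- Here r ≥ 3 enters: q/2 + q/4 + 1 < q amounts to q/4 ≥ 2.
    bound : suc (M ℕ.+ H) < 2 ℕ.^ suc R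
    bound = subst₂ _<_ (ℕ.+-suc M H) (trans (cong (M ℕ.+_) (sym M≡H+H)) (sym (2^suc R)))
      (ℕ.+-monoʳ-< M (ℕ.+-monoˡ-≤ H (2^-mono-≤ {1} (ℕ.≤-pred (subst (2 ≤_) (sym 1+predR) 2≤R)))))

    D : ℕ → F
    D i = d ^ (2 ℕ.^ i)

    -- `f₁` and the term D R · x come from x^(q/2) · tr(dx), whose top power x^q is x. `f₂` comes
    -- from x^(q/2) · tr(d/x), whose last term is the constant `D R`, kept outside `f`.
    f₁ f₂ f : F → F
    f₁ x = Σ[ R ] (λ i → D (toℕ i) * x ^ (M ℕ.+ 2 ℕ.^ toℕ i))
    f₂ x = Σ[ R ] (λ i → D (toℕ i) * x ^ (M ℕ.∸ 2 ℕ.^ toℕ i))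
    f x = (f₁ x + D R * x ^ 1) + f₂ x

    f-poly : Poly₀ (M ℕ.+ H) f
    f-poly = poly₀-+
      (poly₀-+
        (poly₀-Σ R (λ i → poly₀-scale (D (toℕ i))
          (poly₀-^ (ℕ.≤-trans (ℕ.m^n>0 2 R) (ℕ.m≤m+n M _)) (ℕ.+-monoʳ-≤ M (2^i≤H (toℕ<n i))))))
        (poly₀-scale (D R) (poly₀-^ (s≤s z≤n) (ℕ.≤-trans (ℕ.m^n>0 2 R) (ℕ.m≤m+n M H)))))
      (poly₀-Σ R (λ i → poly₀-scale (D (toℕ i))
          (poly₀-^ (ℕ.m<n⇒0<n∸m (2^-mono-< (toℕ<n i))) (ℕ.≤-trans (ℕ.m∸n≤m M (2 ℕ.^ toℕ i)) (ℕ.m≤m+n M H)))))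

    tr-last : ∀ z → tr z ≡ Σ[ R ] (λ i → z ^ (2 ℕ.^ toℕ i)) + z ^ M
    tr-last z = Σ-last R (λ i → z ^ (2 ℕ.^ i))

    distribute : ∀ a z → a * tr z ≡ Σ[ R ] (λ i → a * z ^ (2 ℕ.^ toℕ i)) + a * z ^ M
    distribute a z = trans (cong (a *_) (tr-last z)) (trans (distribˡ a _ _) (cong (_+ a * z ^ M) (Σ-*ˡ R a _)))

    raise : ∀ x e → x ^ M * (d * x) ^ e ≡ d ^ e * x ^ (M ℕ.+ e)
    raise x e = begin
      x ^ M * (d * x) ^ e      ≡⟨ cong (x ^ M *_) (*-^ d x e) ⟩
      x ^ M * (d ^ e * x ^ e)  ≡⟨ solve 3 (λ a b c → a :* (b :* c) := b :* (a :* c)) refl (x ^ M) (d ^ e) (x ^ e) ⟩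
      d ^ e * (x ^ M * x ^ e)  ≡⟨ cong (d ^ e *_) (^-+ x M e) ⟨
      d ^ e * x ^ (M ℕ.+ e)    ∎

    lower : ∀ x y e → x * y ≡ 1# → e ≤ M → x ^ M * (d * y) ^ e ≡ d ^ e * x ^ (M ℕ.∸ e)
    lower x y e xy≡1 e≤M = begin
      x ^ M * (d * y) ^ e                        ≡⟨ cong₂ (λ k s → x ^ k * s) (sym (ℕ.m∸n+n≡m e≤M)) (*-^ d y e) ⟩
      x ^ (M ℕ.∸ e ℕ.+ e) * (d ^ e * y ^ e)      ≡⟨ cong (_* (d ^ e * y ^ e)) (^-+ x (M ℕ.∸ e) e) ⟩
      (x ^ (M ℕ.∸ e) * x ^ e) * (d ^ e * y ^ e)  ≡⟨ solve 4 (λ a b c s → (a :* b) :* (c :* s) := (c :* a) :* (b :* s)) refl _ _ _ _ ⟩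
      (d ^ e * x ^ (M ℕ.∸ e)) * (x ^ e * y ^ e)  ≡⟨ cong (d ^ e * x ^ (M ℕ.∸ e) *_) (trans (sym (*-^ x y e)) (trans (cong (_^ e) xy≡1) (1^ e))) ⟩
      (d ^ e * x ^ (M ℕ.∸ e)) * 1#               ≡⟨ *-identityʳ _ ⟩
      d ^ e * x ^ (M ℕ.∸ e)                      ∎

    x^[M+M]≡x^1 : ∀ x → x ^ (M ℕ.+ M) ≡ x ^ 1
    x^[M+M]≡x^1 x = trans (cong (x ^_) (sym (2^suc R))) (trans (x^q≡x x) (sym (*-identityʳ x)))

    vanishes : ∀ x → x ≢ 0# → D R + f x ≡ 0#
    vanishes x x≢0 with y , xy≡1 ← inverse x x≢0 = begin
      D R + ((f₁ x + D R * x ^ 1) + f₂ x)              ≡⟨ solve 3 (λ a b s → a :+ (b :+ s) := b :+ (s :+ a)) refl (D R) _ (f₂ x) ⟩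
      (f₁ x + D R * x ^ 1) + (f₂ x + D R)              ≡⟨ cong₂ _+_ multiple₁ multiple₂ ⟨
      x ^ M * tr (d * x) + x ^ M * tr (d * y)          ≡⟨ distribˡ (x ^ M) _ _ ⟨
      x ^ M * (tr (d * x) + tr (d * y))                ≡⟨ cong (x ^ M *_) (trans (sym (tr-+ _ _)) (trans (cong tr (sym (distribˡ d x y))) (h x y xy≡1))) ⟩
      x ^ M * 0#                                       ≡⟨ zeroʳ _ ⟩
      0#                                               ∎
      where
      multiple₁ : x ^ M * tr (d * x) ≡ f₁ x + D R * x ^ 1
      multiple₁ = trans (distribute (x ^ M) (d * x)) (cong₂ _+_
        (Σ-cong R (λ i → raise x (2 ℕ.^ toℕ i)))
        (trans (raise x M) (cong (D R *_) (x^[M+M]≡x^1 x))))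
      multiple₂ : x ^ M * tr (d * y) ≡ f₂ x + D R
      multiple₂ = trans (distribute (x ^ M) (d * y)) (cong₂ _+_
        (Σ-cong R (λ i → lower x y (2 ℕ.^ toℕ i) xy≡1 (2^-mono-≤ (ℕ.<⇒≤ (toℕ<n i)))))
        (trans (lower x y M xy≡1 ℕ.≤-refl) (trans (cong (λ k → D R * x ^ k) (ℕ.n∸n≡0 M)) (*-identityʳ _))))

  -- Separation for the orthogonal groups.

  diagonal-separating : ∀ {G : Mat 2 → Set} → (∀ h → SO⁺ 1 h → G h) → 2 ≤ R → (L : Listing 2 G) → Separating L
  diagonal-separating SO⁺⊆G 2≤R L d e = tr-x+1/x 2≤R d λ x y xy≡1 → trans
    -- The trace of `diagonal x y` unfolds to x + (y + 0).
    (cong (λ z → tr (d * (x + z))) (sym (+-identityʳ y)))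
    (listed-trace L e (diagonal x y) (SO⁺⊆G _ (diagonal∈SO⁺ x y xy≡1)))

  SO⁺₄-separating : (L : Listing 4 (SO⁺ 2)) → Separating L
  SO⁺₄-separating L d e = tr-nondegenerate d λ t → trans
    (cong tr (trans (*-comm t d) (cong (d *_) (sym (Tr-twist t)))))
    (listed-trace L e (twist t) (twist∈SO⁺ t))

theorem12 : (r : ℕ) (K : FiniteField2 r) → let open Over K in
    (3 ≤ r → ((L : Listing 2 (SO⁺ 1)) → IsIsoOntoDual L)
    × ((L : Listing 2 (O⁺ 1)) → IsIsoOntoDual L))
    × (1 ≤ r → (L : Listing 4 (SO⁺ 2)) → IsIsoOntoDual L)
-- Both 3 ≤ 0 and 1 ≤ 0 are absurd, which leaves r = R + 1 and q/2 = 2^R.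
theorem12 zero    K = (λ ()) , (λ ())
theorem12 (suc R) K =
    (λ { (s≤s 2≤R) → (λ L → separating⇒iso L (diagonal-separating (λ _ h∈SO → h∈SO) 2≤R L))
                   , (λ L → separating⇒iso L (diagonal-separating (λ _ → proj₁) 2≤R L)) })
  , λ _ L → separating⇒iso L (SO⁺₄-separating L)
  where open TraceCode K
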